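{- For all sufficiently large $n$, \[ \frac{n}{12}\le wt(n)\le \frac{n}{2}-\Omega(n^{1/3}), \] i.e., every permutation of $[n]$ contains weak twins of length at least $n/12$, and there is a constant $c>0$ such that for all large $n$ there exists a permutation of $[n]$ containing no weak twins of length greater than $n/2-cn^{1/3}$.
   Context: A permutation is a finite sequence of distinct positive integers; an $n$-permutation is a permutation of $[n]=\{1,\dots,n\}$. The shape of a permutation $(x_1,\dots,x_w)$ is the sequence $(s_1,\dots,s_{w-1})\in\{+,-\}^{w-1}$ with $s_i=+$ iff $x_i<x_{i+1}$. Two permutations of the same length are weakly similar if they have the same shape. A sub-permutation of $\pi$ is a subsequence $(\pi(i_1),\dots,\pi(i_j))$ with $i_1<\dots<i_j$. Weak twins in $\pi$ are two disjoint (no common positions) weakly similar sub-permutations of $\pi$; their length is the length of one of them. $wt(\pi)$ is the largest $w$ such that $\pi$ contains weak twins of length $w$, and $wt(n)$ is the minimum of $wt(\pi)$ over all $n$-permutations $\pi$. -}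

module Defs where

open import Data.Nat using (ℕ; suc)
open import Data.Fin using (Fin; toℕ; _<_)
open import Data.Fin.Permutation using (Permutation′; _⟨$⟩ʳ_)
open import Data.Product using (Σ; _×_)
open import Relation.Binary.PropositionalEquality using (_≡_; _≢_)
open import Function.Bundles using (_⇔_)

-- An n-permutation, viewed as the sequence (π 0, ..., π (n-1)) of values in Fin n
-- (0-based encoding of [n]; only relative order matters for shapes).

StrictlyIncreasing : {w n : ℕ} → (Fin w → Fin n) → Set
StrictlyIncreasing {w} I = (a b : Fin w) → a < b → I a < I b

SameShape : {w n : ℕ} → (Fin w → Fin n) → (Fin w → Fin n) → Set
SameShape {w} x y =
  (a b : Fin w) → toℕ b ≡ suc (toℕ a) → (x a < x b) ⇔ (y a < y b)

HasWeakTwins : {n : ℕ} → Permutation′ n → ℕ → Set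
HasWeakTwins {n} π w =
  Σ (Fin w → Fin n) λ I → Σ (Fin w → Fin n) λ J →
    StrictlyIncreasing I × StrictlyIncreasing J ×
    ((a b : Fin w) → I a ≢ J b) ×
    SameShape (λ a → π ⟨$⟩ʳ I a) (λ a → π ⟨$⟩ʳ J a)

{-# OPTIONS --safe #-}
module Submission where

open import Defs
open import Data.Nat using (ℕ; zero; suc; _≤_; _<_; _+_; _*_; _∸_; _^_; _/_; _%_; z≤n; s≤s; z<s; NonZero)
open import Data.Nat.Properties
open import Data.Nat.DivMod using (/-monoˡ-≤; m*n/n≡m; m<n⇒m/n≡0; +-distrib-/-∣ʳ; m≡m%n+[m/n]*n; m%n<n)
open import Data.Nat.Divisibility using (n∣m*n)
open import Data.Nat.ListAction using (sum)
open import Data.Nat.Tactic.RingSolver using (solve-∀)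
open import Data.Empty using (⊥)
open import Data.Fin as Fin using (Fin; toℕ; fromℕ<; splitAt; join; _↑ˡ_; _↑ʳ_)
open import Data.Fin.Properties using (toℕ-fromℕ<; toℕ-injective; toℕ<n; toℕ-↑ˡ; toℕ-↑ʳ; toℕ-cast; +↔⊎; splitAt-↑ˡ; splitAt-↑ʳ; join-splitAt; fromℕ<-injective; injective⇒≤)
open import Data.Fin.Permutation using (Permutation′; _⟨$⟩ʳ_; cast-id; id)
open import Data.List using (List; []; _∷_; tabulate)
open import Data.List.Relation.Unary.All as All using (All; []; _∷_)
import Data.List.Relation.Unary.All.Properties as All
open import Data.List.Relation.Unary.AllPairs as AllPairs using (AllPairs; []; _∷_)
import Data.List.Relation.Unary.AllPairs.Properties as AllPairs
import Data.List.Relation.Unary.Sorted.TotalOrder.Properties as Sorted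
open import Data.List.Relation.Binary.Permutation.Propositional using (_↭_; ↭-sym)
open import Data.List.Relation.Binary.Permutation.Propositional.Properties using (All-resp-↭; ↭-length)
import Data.List.Relation.Binary.Permutation.Setoid as SetoidPermutation
import Data.List.Relation.Binary.Permutation.Setoid.Properties as SetoidPermutation
import Data.List.Sort as Sort
open import Data.Product using (Σ; ∃; _×_; _,_)
open import Data.Sum using (_⊎_; inj₁; inj₂; [_,_])
open import Data.Sum.Algebra using (⊎-comm)
open import Data.Sum.Function.Propositional using (_⊎-↔_)
open import Function using (_∘_; _on_)
open import Function.Bundles using (_⇔_; mk⇔; Injection; module Equivalence)
open import Function.Construct.Composition using (_↔-∘_; _⇔-∘_)
open import Function.Construct.Symmetry using (⇔-sym; ↔-sym)
open import Function.Definitions using (Injective)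
open import Function.Properties.Inverse using (↔⇒↣)
open import Relation.Binary.Bundles using (DecTotalOrder)
open import Relation.Binary.Definitions using (tri<; tri≈; tri>)
import Relation.Binary.Construct.On as On
open import Relation.Binary.PropositionalEquality using (_≡_; _≢_; refl; sym; trans; cong; cong₂; subst; subst₂; module ≡-Reasoning)
open import Relation.Nullary using (¬_; Dec; yes; no; contradiction)

open Equivalence using (to; from)

-- Lower bound.  Cut the positions into blocks of four and take from each block one
-- pair, the smaller value for the first twin and the larger for the second.  The
-- result is a pair of weak twins as soon as consecutive pairs, viewed as intervals
-- of values, are not nested.  Working from the last block to the first, keep two
-- families of twins whose leading intervals lie one above the other: a new pair fails
-- to extend both only if its interval covers both leading intervals, and for sorted
-- values r₀ < r₁ < r₂ < r₃ two of [r₀,r₁], [r₁,r₂], [r₂,r₃] do not.  This yields n/4.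
--
-- Upper bound.  Let π increase on consecutive blocks, each later block lying below the
-- earlier ones, so that descents of a subsequence are exactly its changes of block.
-- Use about k = n^(1/3) blocks of odd sizes decreasing in steps of 2k.  While the twins
-- use equally many elements of each block, parity wastes one element per block.  At
-- the first block where the numbers differ, one twin must avoid the block entirely and
-- the other one's run there is copied inside a smaller block, which wastes 2k elements.

-- Lower bound: weak twins from blocks of four positions.

module _ {A : Set} (h : A → ℕ) where

  private
    O = On.decTotalOrder ≤-decTotalOrder h
    module O = DecTotalOrder O

  strictlySort : ∀ xs → AllPairs (_≢_ on h) xs →
                 ∃ λ ys → ys ↭ xs × AllPairs (_<_ on h) ys
  strictlySort xs distinct = Sort.sort O xs , Sort.sort-↭ O xs ,
    AllPairs.zipWith (λ (x≤y , x≢y) → ≤∧≢⇒< x≤y x≢y)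
      ( Sorted.Sorted⇒AllPairs O.totalOrder (Sort.sort-↗ O xs)
      , SetoidPermutation.Unique-resp-↭ O.Eq.setoid
          (SetoidPermutation.↭-sym O.Eq.setoid (SortingAlgorithm.sort-↭ₛ (Sort.sortingAlgorithm O) xs))
          distinct )
    where open import Data.List.Sort.Base O.totalOrder using (module SortingAlgorithm)

module BlockTwins {n : ℕ} (h : Fin n → ℕ) (h-injective : Injective _≡_ _≡_ h) where

  InBlock : ℕ → Fin n → Set
  InBlock b p = toℕ p / 4 ≡ b

  record SortedBlock (b : ℕ) : Set where
    constructor sortedBlock
    field
      {r₀ r₁ r₂ r₃} : Fin n
      in₀ : InBlock b r₀
      in₁ : InBlock b r₁
      in₂ : InBlock b r₂
      in₃ : InBlock b r₃
      r₀<r₁ : h r₀ < h r₁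
      r₁<r₂ : h r₁ < h r₂
      r₂<r₃ : h r₂ < h r₃

  sortBlock : ∀ b → suc b * 4 ≤ n → SortedBlock b
  sortBlock b fits = build (strictlySort h (tabulate pos) (AllPairs.tabulate⁺ distinct))
    where
    pos<n : (i : Fin 4) → toℕ i + b * 4 < n
    pos<n i = <-≤-trans (+-monoˡ-< (b * 4) (toℕ<n i)) fits

    pos : Fin 4 → Fin n
    pos i = fromℕ< (pos<n i)

    pos-in : ∀ i → InBlock b (pos i)
    pos-in i = begin
      toℕ (pos i) / 4          ≡⟨ cong (_/ 4) (toℕ-fromℕ< (pos<n i)) ⟩
      (toℕ i + b * 4) / 4      ≡⟨ +-distrib-/-∣ʳ (toℕ i) (n∣m*n b) ⟩
      toℕ i / 4 + b * 4 / 4    ≡⟨ cong₂ _+_ (m<n⇒m/n≡0 (toℕ<n i)) (m*n/n≡m b 4) ⟩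
      b                        ∎
      where open ≡-Reasoning

    distinct : ∀ {i j} → i ≢ j → h (pos i) ≢ h (pos j)
    distinct {i} {j} i≢j eq = i≢j (toℕ-injective (+-cancelʳ-≡ (b * 4) (toℕ i) (toℕ j)
      (trans (sym (toℕ-fromℕ< (pos<n i)))
        (trans (cong toℕ (h-injective eq)) (toℕ-fromℕ< (pos<n j))))))

    build : (∃ λ ys → ys ↭ tabulate pos × AllPairs (_<_ on h) ys) → SortedBlock b
    build (ys , ys↭ , sorted) with ys | ↭-length ys↭ | All-resp-↭ (↭-sym ys↭) (All.tabulate⁺ {f = pos} pos-in) | sorted
    ... | _ ∷ _ ∷ _ ∷ _ ∷ [] | refl | i₀ ∷ i₁ ∷ i₂ ∷ i₃ ∷ []
        | (lt₀ ∷ _) ∷ (lt₁ ∷ _) ∷ (lt₂ ∷ _) ∷ _ = sortedBlock i₀ i₁ i₂ i₃ lt₀ lt₁ lt₂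

  -- With `I a` and `J a` both in block `a + b`, monotonicity of positions is automatic, and `I<J`
  -- yields disjointness. Total functions make prepending a pair easy; only indices below `m`
  -- matter.
  record TwinsFrom (b m : ℕ) : Set where
    field
      I J     : ℕ → Fin n
      I-block : ∀ a → a < m → InBlock (a + b) (I a)
      J-block : ∀ a → a < m → InBlock (a + b) (J a)
      I<J     : ∀ a → a < m → h (I a) < h (J a)
      shape   : ∀ a → suc a < m → h (I a) < h (I (suc a)) ⇔ h (J a) < h (J (suc a))

  open TwinsFrom

  private
    _◂_ : Fin n → (ℕ → Fin n) → ℕ → Fin n
    (p ◂ f) zero    = p
    (p ◂ f) (suc a) = f a

  single : ∀ {b p q} → InBlock b p → InBlock b q → h p < h q → TwinsFrom b 1
  single {p = p} {q} p-in q-in p<q = record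
    { I       = λ _ → p
    ; J       = λ _ → q
    ; I-block = λ { zero _ → p-in ; (suc _) (s≤s ()) }
    ; J-block = λ { zero _ → q-in ; (suc _) (s≤s ()) }
    ; I<J     = λ _ _ → p<q
    ; shape   = λ { _ (s≤s ()) }
    }

  extend : ∀ {b m p q} (T : TwinsFrom (suc b) m) →
           InBlock b p → InBlock b q → h p < h q →
           h p < h (I T 0) ⇔ h q < h (J T 0) → TwinsFrom b (suc m)
  extend {b} {p = p} {q} T p-in q-in p<q p⇔q = record
    { I       = p ◂ I T
    ; J       = q ◂ J T
    ; I-block = λ { zero _ → p-in ; (suc a) (s≤s a<m) → trans (I-block T a a<m) (+-suc a b) }
    ; J-block = λ { zero _ → q-in ; (suc a) (s≤s a<m) → trans (J-block T a a<m) (+-suc a b) }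
    ; I<J     = λ { zero _ → p<q ; (suc a) (s≤s a<m) → I<J T a a<m }
    ; shape   = λ { zero _ → p⇔q ; (suc a) (s≤s a<m) → shape T a a<m }
    }

  -- The two families are alternatives and may share positions. Only head pairs are compared, since
  -- prepending creates one new comparison; `separated` is weak because neighbouring sorted pairs
  -- share an endpoint.
  record TwoTwins (b m : ℕ) : Set where
    constructor twoTwins
    field
      low high  : TwinsFrom b (suc m)
      separated : h (J low 0) ≤ h (I high 0)

  open TwoTwins

  -- Failure for both families would need {p, q} to span the two head pairs.
  extendEither : ∀ {b m p q} (T : TwoTwins (suc b) m) →
                 InBlock b p → InBlock b q → h p < h q →
                 h (I (low T) 0) ≤ h p ⊎ h q < h (J (high T) 0) →
                 Σ (TwinsFrom b (suc (suc m))) λ T′ → I T′ 0 ≡ p × J T′ 0 ≡ q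
  extendEither {p = p} {q} T p-in q-in p<q notSpanning
    with h p <? h (I (low T) 0) | h q <? h (J (low T) 0)
  ... | yes p<I | yes q<J =
        extend (low T) p-in q-in p<q (mk⇔ (λ _ → q<J) (λ _ → p<I)) , refl , refl
  ... | no p≮I | no q≮J =
        extend (low T) p-in q-in p<q
          (mk⇔ (λ p<I → contradiction p<I p≮I) (λ q<J → contradiction q<J q≮J)) , refl , refl
  -- The new interval lies inside the low head interval, hence below the high one.
  ... | no _ | yes q<J =
        extend (high T) p-in q-in p<q
          (mk⇔ (λ _ → <-trans q<I′ (I<J (high T) 0 z<s)) (λ _ → <-trans p<q q<I′)) , refl , refl
    where q<I′ = <-≤-trans q<J (separated T)
  ... | yes p<I | no _ with notSpanning
  ...   | inj₁ I≤p  = contradiction p<I (≤⇒≯ I≤p)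
  -- The new interval covers the low head interval but ends below the top of the high one, so both
  -- comparisons with the high head are ascents.
  ...   | inj₂ q<J′ =
        extend (high T) p-in q-in p<q
          (mk⇔ (λ _ → q<J′)
               (λ _ → <-≤-trans p<I (≤-trans (<⇒≤ (I<J (low T) 0 z<s)) (separated T)))) , refl , refl

  pair : ∀ {b m p q p′ q′} →
         (Σ (TwinsFrom b (suc m)) λ T → I T 0 ≡ p × J T 0 ≡ q) →
         (Σ (TwinsFrom b (suc m)) λ T → I T 0 ≡ p′ × J T 0 ≡ q′) →
         h q ≤ h p′ → TwoTwins b m
  pair (T , _ , refl) (T′ , refl , _) q≤p′ = twoTwins T T′ q≤p′

  -- The value `h (I (low T) 0)` is a threshold: an interval starting at or above it, or ending
  -- below it, meets the hypothesis of `extendEither`. Only the interval crossing it can fail, and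
  -- the other two are already in order.
  extendTwo : ∀ {b m} → SortedBlock b → TwoTwins (suc b) m → TwoTwins b (suc m)
  extendTwo (sortedBlock {r₀} {r₁} {r₂} {r₃} in₀ in₁ in₂ in₃ r₀<r₁ r₁<r₂ r₂<r₃) T =
    choose (h (I (low T) 0) ≤? h r₁) (h (I (low T) 0) ≤? h r₂)
    where
    low<high : h (I (low T) 0) < h (J (high T) 0)
    low<high = <-trans (<-≤-trans (I<J (low T) 0 z<s) (separated T)) (I<J (high T) 0 z<s)

    below : ∀ {r} → ¬ (h (I (low T) 0) ≤ h r) → h r < h (J (high T) 0)
    below I≰r = <-trans (≰⇒> I≰r) low<high

    choose : Dec (h (I (low T) 0) ≤ h r₁) → Dec (h (I (low T) 0) ≤ h r₂) → TwoTwins _ _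
    choose (yes I≤r₁) (yes I≤r₂) =
      pair (extendEither T in₁ in₂ r₁<r₂ (inj₁ I≤r₁)) (extendEither T in₂ in₃ r₂<r₃ (inj₁ I≤r₂)) ≤-refl
    choose (no I≰r₁) (yes I≤r₂) =
      pair (extendEither T in₀ in₁ r₀<r₁ (inj₂ (below I≰r₁)))
           (extendEither T in₂ in₃ r₂<r₃ (inj₁ I≤r₂)) (<⇒≤ r₁<r₂)
    choose (yes I≤r₁) (no I≰r₂) = contradiction (≤-trans I≤r₁ (<⇒≤ r₁<r₂)) I≰r₂
    choose (no I≰r₁) (no I≰r₂) =
      pair (extendEither T in₀ in₁ r₀<r₁ (inj₂ (below I≰r₁)))
           (extendEither T in₁ in₂ r₁<r₂ (inj₂ (below I≰r₂))) ≤-refl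

  twoTwinsFrom : ∀ m b → (suc m + b) * 4 ≤ n → TwoTwins b m
  -- In the last block the lower and upper halves of the sorted values start the two families.
  twoTwinsFrom zero b fits = twoTwins (single in₀ in₁ r₀<r₁) (single in₂ in₃ r₂<r₃) (<⇒≤ r₁<r₂)
    where open SortedBlock (sortBlock b fits)
  twoTwinsFrom (suc m) b fits =
    extendTwo
      (sortBlock b (≤-trans (*-monoˡ-≤ 4 (s≤s (m≤n+m b (suc m)))) fits))
      (twoTwinsFrom m (suc b) (subst (λ x → x * 4 ≤ n) (cong suc (sym (+-suc m b))) fits))

value : ∀ {n} → Permutation′ n → Fin n → ℕ
value π p = toℕ (π ⟨$⟩ʳ p)

value-injective : ∀ {n} (π : Permutation′ n) → Injective _≡_ _≡_ (value π)
value-injective π = Injection.injective (↔⇒↣ π) ∘ toℕ-injective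

blockTwins⇒weakTwins : ∀ {n w} (π : Permutation′ n) →
                       BlockTwins.TwinsFrom (value π) (value-injective π) 0 w → HasWeakTwins π w
blockTwins⇒weakTwins {n} {w} π T =
    (λ a → I (toℕ a)) , (λ a → J (toℕ a)) ,
    increasing I I-block , increasing J J-block , disjoint , sameShape
  where
  open BlockTwins (value π) (value-injective π)
  open TwinsFrom T

  increasing : (K : ℕ → Fin n) → (∀ a → a < w → InBlock (a + 0) (K a)) →
               StrictlyIncreasing (λ (a : Fin w) → K (toℕ a))
  increasing K block a b a<b = ≰⇒> λ Kb≤Ka → <⇒≱ a<b
    (+-cancelʳ-≤ 0 (toℕ b) (toℕ a)
      (subst₂ _≤_ (block _ (toℕ<n b)) (block _ (toℕ<n a)) (/-monoˡ-≤ 4 Kb≤Ka)))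

  disjoint : (a b : Fin w) → I (toℕ a) ≢ J (toℕ b)
  disjoint a b eq = <⇒≢ (I<J (toℕ a) (toℕ<n a)) (cong (value π) (trans eq (cong J (sym a≡b))))
    where
    a≡b : toℕ a ≡ toℕ b
    a≡b = +-cancelʳ-≡ 0 (toℕ a) (toℕ b)
      (trans (sym (I-block _ (toℕ<n a))) (trans (cong (λ p → toℕ p / 4) eq) (J-block _ (toℕ<n b))))

  sameShape : SameShape (λ (a : Fin w) → π ⟨$⟩ʳ I (toℕ a)) (λ a → π ⟨$⟩ʳ J (toℕ a))
  sameShape a b b≡1+a rewrite b≡1+a = shape (toℕ a) (subst (_< w) b≡1+a (toℕ<n b))

lowerBound : ∀ n → 4 ≤ n → (π : Permutation′ n) → Σ ℕ λ w → HasWeakTwins π w × n ≤ 12 * w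
lowerBound n 4≤n π with n / 4 in eq | /-monoˡ-≤ 4 4≤n
-- The second scrutinee proves `1 ≤ n / 4`, excluding a zero quotient.
... | suc m | _ =
    suc m , blockTwins⇒weakTwins π (TwoTwins.low (twoTwinsFrom m 0 fits)) , n≤12w
  where
  open BlockTwins (value π) (value-injective π)

  n≡ : n ≡ n % 4 + suc m * 4
  n≡ = trans (m≡m%n+[m/n]*n n 4) (cong (λ x → n % 4 + x * 4) eq)

  fits : (suc m + 0) * 4 ≤ n
  fits = subst₂ _≤_ (cong (_* 4) (sym (+-identityʳ (suc m)))) (sym n≡) (m≤n+m (suc m * 4) (n % 4))

  -- The remainder is below 4, and `4 ≤ 4w` because `w = suc m`; hence even `n ≤ 8w`.
  n≤12w : n ≤ 12 * suc m
  n≤12w = begin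
    n                     ≡⟨ n≡ ⟩
    n % 4 + suc m * 4     ≤⟨ +-monoˡ-≤ (suc m * 4) (<⇒≤ (m%n<n n 4)) ⟩
    4 + suc m * 4         ≤⟨ +-monoˡ-≤ (suc m * 4) (m≤n*m 4 (suc m)) ⟩
    suc m * 4 + suc m * 4 ≡⟨ *-distribˡ-+ (suc m) 4 4 ⟨
    suc m * 8             ≤⟨ *-monoʳ-≤ (suc m) (m≤m+n 8 4) ⟩
    suc m * 12            ≡⟨ *-comm (suc m) 12 ⟩
    12 * suc m            ∎
    where open ≤-Reasoning

-- Layered permutations and their ascents.

-- Positions s, s + 1, … are cut into consecutive blocks of the given sizes; the
-- encoding is meant for i ≤ j only.
SameBlock : ℕ → List ℕ → ℕ → ℕ → Set
SameBlock s []       i j = ⊥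
SameBlock s (L ∷ Ls) i j = (s ≤ i × j < s + L) ⊎ SameBlock (s + L) Ls i j

sameBlock-≥ : ∀ s Ls {i j} → SameBlock s Ls i j → s ≤ i
sameBlock-≥ s (L ∷ Ls) (inj₁ (s≤i , _)) = s≤i
sameBlock-≥ s (L ∷ Ls) (inj₂ ij)        = ≤-trans (m≤m+n s L) (sameBlock-≥ (s + L) Ls ij)

sameBlock-trans : ∀ s Ls {i j k} → i ≤ k → SameBlock s Ls i j → SameBlock s Ls j k → SameBlock s Ls i k
sameBlock-trans s (L ∷ Ls) i≤k (inj₁ (s≤i , _))  (inj₁ (_ , k<)) = inj₁ (s≤i , k<)
sameBlock-trans s (L ∷ Ls) i≤k (inj₁ (_ , j<))   (inj₂ jk)       = contradiction j< (≤⇒≯ (sameBlock-≥ (s + L) Ls jk))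
sameBlock-trans s (L ∷ Ls) i≤k (inj₂ ij)         (inj₁ (_ , k<)) =
  contradiction k< (≤⇒≯ (≤-trans (sameBlock-≥ (s + L) Ls ij) i≤k))
sameBlock-trans s (L ∷ Ls) i≤k (inj₂ ij)         (inj₂ jk)       = inj₂ (sameBlock-trans (s + L) Ls i≤k ij jk)

sameBlock-< : ∀ s Ls {M i j} → All (_≤ M) Ls → SameBlock s Ls i j → j < i + M
sameBlock-< s (L ∷ Ls) (L≤M ∷ _)  (inj₁ (s≤i , j<)) = <-≤-trans j< (+-mono-≤ s≤i L≤M)
sameBlock-< s (L ∷ Ls) (_ ∷ Ls≤M) (inj₂ ij)         = sameBlock-< (s + L) Ls Ls≤M ij

-- Increasing on every block, with later blocks below earlier ones.
layered : (Ls : List ℕ) → Permutation′ (sum Ls)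
layered []       = id
layered (L ∷ Ls) =
  cast-id (+-comm (sum Ls) L) ↔-∘
  (↔-sym +↔⊎ ↔-∘ (⊎-comm (Fin L) (Fin (sum Ls)) ↔-∘ ((id ⊎-↔ layered Ls) ↔-∘ +↔⊎)))

layered-↑ˡ : ∀ L Ls (i : Fin L) → toℕ (layered (L ∷ Ls) ⟨$⟩ʳ (i ↑ˡ sum Ls)) ≡ sum Ls + toℕ i
layered-↑ˡ L Ls i rewrite splitAt-↑ˡ L i (sum Ls) = trans (toℕ-cast _ (sum Ls ↑ʳ i)) (toℕ-↑ʳ (sum Ls) i)

layered-↑ʳ : ∀ L Ls (i : Fin (sum Ls)) → toℕ (layered (L ∷ Ls) ⟨$⟩ʳ (L ↑ʳ i)) ≡ toℕ (layered Ls ⟨$⟩ʳ i)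
layered-↑ʳ L Ls i rewrite splitAt-↑ʳ L (sum Ls) i =
  trans (toℕ-cast _ ((layered Ls ⟨$⟩ʳ i) ↑ˡ L)) (toℕ-↑ˡ (layered Ls ⟨$⟩ʳ i) L)

-- Reduces shapes to positions: first-block values exceed all later ones, and within a block order
-- is kept. The offset `s` lets the induction pass to the tail, whose blocks start at `s + L`.
layered-ascent : ∀ Ls s (i j : Fin (sum Ls)) → i Fin.< j →
  (layered Ls ⟨$⟩ʳ i) Fin.< (layered Ls ⟨$⟩ʳ j) ⇔ SameBlock s Ls (s + toℕ i) (s + toℕ j)
layered-ascent (L ∷ Ls) s i j i<j =
  subst₂ Claim (join-splitAt L r i) (join-splitAt L r j)
    (claim (splitAt L i) (splitAt L j)
      (subst₂ Fin._<_ (sym (join-splitAt L r i)) (sym (join-splitAt L r j)) i<j))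
  where
  r = sum Ls

  Claim : Fin (L + r) → Fin (L + r) → Set
  Claim i j = (layered (L ∷ Ls) ⟨$⟩ʳ i) Fin.< (layered (L ∷ Ls) ⟨$⟩ʳ j)
                ⇔ SameBlock s (L ∷ Ls) (s + toℕ i) (s + toℕ j)

  claim : ∀ x y → join L r x Fin.< join L r y → Claim (join L r x) (join L r y)
  claim (inj₁ a) (inj₁ b) a<b
    rewrite layered-↑ˡ L Ls a | layered-↑ˡ L Ls b | toℕ-↑ˡ a r | toℕ-↑ˡ b r =
    mk⇔ (λ _ → inj₁ (m≤m+n s _ , +-monoʳ-< s (toℕ<n b))) (λ _ → +-monoʳ-< r a<b)
  claim (inj₁ a) (inj₂ b) _
    rewrite layered-↑ˡ L Ls a | layered-↑ʳ L Ls b | toℕ-↑ˡ a r | toℕ-↑ʳ L b =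
    mk⇔ (λ lt → contradiction (<-trans lt (toℕ<n (layered Ls ⟨$⟩ʳ b))) (m+n≮m r (toℕ a)))
        λ { (inj₁ (_ , lt)) → contradiction (+-cancelˡ-< s _ _ lt) (m+n≮m L (toℕ b))
          ; (inj₂ ab) → contradiction (+-cancelˡ-≤ s _ _ (sameBlock-≥ (s + L) Ls ab)) (<⇒≱ (toℕ<n a)) }
  claim (inj₂ a) (inj₁ b) a<b
    rewrite toℕ-↑ʳ L a | toℕ-↑ˡ b r = contradiction (<-trans a<b (toℕ<n b)) (m+n≮m L (toℕ a))
  claim (inj₂ a) (inj₂ b) a<b
    rewrite layered-↑ʳ L Ls a | layered-↑ʳ L Ls b | toℕ-↑ʳ L a | toℕ-↑ʳ L b
          | sym (+-assoc s L (toℕ a)) | sym (+-assoc s L (toℕ b)) =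
    mk⇔ (inj₂ ∘ to ih)
        λ { (inj₁ (_ , lt)) → contradiction lt (m+n≮m (s + L) (toℕ b)) ; (inj₂ ab) → from ih ab }
    where ih = layered-ascent Ls (s + L) a b (+-cancelˡ-< L _ _ a<b)

-- Increasing position sequences: counting and cutting.

-- Positions are plain numbers in the interval from `s` up to but excluding `e`, so that dropping a
-- prefix is just precomposition with `c +_`.
record Increasing (s e w : ℕ) (F : ℕ → ℕ) : Set where
  field
    mono  : ∀ {x y} → x < y → y < w → F x < F y
    lower : ∀ {x} → x < w → s ≤ F x
    upper : ∀ {x} → x < w → F x < e

open Increasing

Disjoint : ℕ → ℕ → (ℕ → ℕ) → (ℕ → ℕ) → Set
Disjoint a b F G = ∀ {x y} → x < a → y < b → F x ≢ G y

take : ∀ {s e e′ c w F} → c ≤ w → Increasing s e w F → (∀ {x} → x < c → F x < e′) → Increasing s e′ c F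
take c≤w inc below = record
  { mono  = λ x<y y<c → mono inc x<y (<-≤-trans y<c c≤w)
  ; lower = λ x<c → lower inc (<-≤-trans x<c c≤w)
  ; upper = below
  }

drop : ∀ {s s′ e} c {w F} → Increasing s e (c + w) F → (∀ {x} → x < w → s′ ≤ F (c + x)) →
       Increasing s′ e w (F ∘ (c +_))
drop c inc above = record
  { mono  = λ x<y y<w → mono inc (+-monoʳ-< c x<y) (+-monoʳ-< c y<w)
  ; lower = above
  ; upper = λ x<w → upper inc (+-monoʳ-< c x<w)
  }

dropBlock : ∀ {s r} L c {w F} → Increasing s (s + (L + r)) (c + w) F → (∀ {x} → x < w → s + L ≤ F (c + x)) →
            Increasing (s + L) (s + L + r) w (F ∘ (c +_))
dropBlock {s} {r} L c {w} {F} inc above =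
  subst (λ e → Increasing (s + L) e w (F ∘ (c +_))) (sym (+-assoc s L r)) (drop c inc above)

increasing-injective : ∀ {s e w F} → Increasing s e w F → ∀ {x y} → x < w → y < w → F x ≡ F y → x ≡ y
increasing-injective inc {x} {y} x<w y<w eq with <-cmp x y
... | tri< x<y _ _ = contradiction eq (<⇒≢ (mono inc x<y y<w))
... | tri≈ _ x≡y _ = x≡y
... | tri> _ _ y<x = contradiction (sym eq) (<⇒≢ (mono inc y<x x<w))

increasing-gap : ∀ {s e w F} → Increasing s e w F → ∀ x → x < w → F 0 + x ≤ F x
increasing-gap {F = F} inc zero    _   = ≤-reflexive (+-identityʳ (F 0))
increasing-gap {F = F} inc (suc x) x<w = begin
  F 0 + suc x    ≡⟨ +-suc (F 0) x ⟩
  suc (F 0 + x)  ≤⟨ s≤s (increasing-gap inc x (<-trans (n<1+n x) x<w)) ⟩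
  suc (F x)      ≤⟨ mono inc (n<1+n x) x<w ⟩
  F (suc x)      ∎
  where open ≤-Reasoning

-- Shifted down by `s`, the two sequences together inject `Fin (a + b)` into `Fin l`.
disjoint-count : ∀ {s l a b F G} → Increasing s (s + l) a F → Increasing s (s + l) b G →
                 Disjoint a b F G → a + b ≤ l
disjoint-count {s} {l} {a} {b} {F} {G} incF incG disj = injective⇒≤ {f = f} f-injective
  where
  v : Fin a ⊎ Fin b → ℕ
  v = [ F ∘ toℕ , G ∘ toℕ ]

  v-lower : ∀ x → s ≤ v x
  v-lower (inj₁ i) = lower incF (toℕ<n i)
  v-lower (inj₂ i) = lower incG (toℕ<n i)

  v-upper : ∀ x → v x < s + l
  v-upper (inj₁ i) = upper incF (toℕ<n i)
  v-upper (inj₂ i) = upper incG (toℕ<n i)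

  v-injective : ∀ x y → v x ≡ v y → x ≡ y
  v-injective (inj₁ i) (inj₁ j) eq = cong inj₁ (toℕ-injective (increasing-injective incF (toℕ<n i) (toℕ<n j) eq))
  v-injective (inj₁ i) (inj₂ j) eq = contradiction eq (disj (toℕ<n i) (toℕ<n j))
  v-injective (inj₂ i) (inj₁ j) eq = contradiction (sym eq) (disj (toℕ<n j) (toℕ<n i))
  v-injective (inj₂ i) (inj₂ j) eq = cong inj₂ (toℕ-injective (increasing-injective incG (toℕ<n i) (toℕ<n j) eq))

  v∸s<l : ∀ x → v x ∸ s < l
  v∸s<l x = subst (v x ∸ s <_) (m+n∸m≡n s l) (∸-monoˡ-< (v-upper x) (v-lower x))

  f : Fin (a + b) → Fin l
  f z = fromℕ< (v∸s<l (splitAt a z))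

  f-injective : ∀ {y z} → f y ≡ f z → y ≡ z
  f-injective {y} {z} eq = begin
    y                          ≡⟨ join-splitAt a b y ⟨
    join a b (splitAt a y)     ≡⟨ cong (join a b) (v-injective (splitAt a y) (splitAt a z) (∸-cancelʳ-≡ (v-lower (splitAt a y)) (v-lower (splitAt a z))
                                    (fromℕ<-injective _ _ (v∸s<l (splitAt a y)) (v∸s<l (splitAt a z)) eq))) ⟩
    join a b (splitAt a z)     ≡⟨ join-splitAt a b z ⟩
    z                          ∎
    where open ≡-Reasoning

record SplitAt (m w : ℕ) (F : ℕ → ℕ) : Set where
  constructor cut
  field
    size rest : ℕ
    total : w ≡ size + rest
    below : ∀ {x} → x < size → F x < m
    above : ∀ {x} → x < rest → m ≤ F (size + x)

splitIncreasing : ∀ {s e} m w {F} → Increasing s e w F → SplitAt m w F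
splitIncreasing m zero inc = record { size = 0 ; rest = 0 ; total = refl ; below = λ () ; above = λ () }
splitIncreasing m (suc w) {F} inc with F 0 <? m
... | no F0≮m = record
  { size = 0 ; rest = suc w ; total = refl ; below = λ ()
  ; above = λ {x} x<w → ≤-trans (≮⇒≥ F0≮m) (≤-trans (m≤m+n (F 0) x) (increasing-gap inc x x<w)) }
... | yes F0<m = record
  { size = suc size ; rest = rest ; total = cong suc total
  ; below = λ { {zero} _ → F0<m ; {suc x} (s≤s x<c) → below x<c }
  ; above = above }
  where open SplitAt (splitIncreasing m w (drop 1 inc λ x<w → lower inc (s≤s x<w)))

-- Weak twins in a layered permutation and the elements they waste.

Shape : ℕ → List ℕ → ℕ → (ℕ → ℕ) → (ℕ → ℕ) → Set
Shape s Ls w F G = ∀ x → suc x < w →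
  SameBlock s Ls (F x) (F (suc x)) ⇔ SameBlock s Ls (G x) (G (suc x))

record Twins (s : ℕ) (Ls : List ℕ) (w : ℕ) (F G : ℕ → ℕ) : Set where
  field
    incF     : Increasing s (s + sum Ls) w F
    incG     : Increasing s (s + sum Ls) w G
    disjoint : Disjoint w w F G
    shape    : Shape s Ls w F G

open Twins

swap : ∀ {s Ls w F G} → Twins s Ls w F G → Twins s Ls w G F
swap T = record
  { incF = incG T ; incG = incF T
  ; disjoint = λ x<w y<w eq → disjoint T y<w x<w (sym eq)
  ; shape = λ x x<w → ⇔-sym (shape T x x<w) }

sameBlock-tail : ∀ {s L Ls i j} → s + L ≤ j → SameBlock s (L ∷ Ls) i j → SameBlock (s + L) Ls i j
sameBlock-tail ≤j (inj₁ (_ , j<)) = contradiction j< (≤⇒≯ ≤j)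
sameBlock-tail ≤j (inj₂ ij)       = ij

-- Beyond the first block, `SameBlock` for the whole list agrees with `SameBlock` for the tail, so
-- the shape condition restricts.
dropTwins : ∀ {s L Ls} c {w F G} → Twins s (L ∷ Ls) (c + w) F G →
            (∀ {x} → x < w → s + L ≤ F (c + x)) → (∀ {x} → x < w → s + L ≤ G (c + x)) →
            Twins (s + L) Ls w (F ∘ (c +_)) (G ∘ (c +_))
dropTwins {s} {L} {Ls} c {w} {F} {G} T aboveF aboveG = record
  { incF = dropBlock L c (incF T) aboveF
  ; incG = dropBlock L c (incG T) aboveG
  ; disjoint = λ x<w y<w → disjoint T (+-monoʳ-< c x<w) (+-monoʳ-< c y<w)
  ; shape = λ x x<w → mk⇔
      (λ ij → sameBlock-tail (aboveG x<w) (to   (shape′ x x<w) (inj₂ ij)))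
      (λ ij → sameBlock-tail (aboveF x<w) (from (shape′ x x<w) (inj₂ ij)))
  }
  where
  shape′ : ∀ x → suc x < w → SameBlock s (L ∷ Ls) (F (c + x)) (F (c + suc x))
                           ⇔ SameBlock s (L ∷ Ls) (G (c + x)) (G (c + suc x))
  shape′ x x<w rewrite +-suc c x =
    shape T (c + x) (subst (_< c + w) (+-suc c x) (+-monoʳ-< c x<w))

-- If F leaves the first block before G does, then F misses it altogether, and
-- the part of G lying there is copied by F into a single later, shorter block.
desynchronised : ∀ {s L Ls w F G M} → Twins s (L ∷ Ls) w F G → All (_≤ M) Ls → 1 ≤ M →
  (A : SplitAt (s + L) w F) (B : SplitAt (s + L) w G) → SplitAt.size A < SplitAt.size B →
  w + w ≤ M + sum Ls
desynchronised {s} {L} {Ls} {F = F} T _ _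
  (cut (suc c) w₁ refl belowF aboveF) (cut d w₂ d+w₂≡w belowG _) c<d =
  -- `F c` is the last element of `F` in the first block, so its next step changes block, while `G`
  -- stays inside because `suc c < d`.
  contradiction (from (shape T c 1+c<w) (inj₁ (lower (incG T) (<-trans (n<1+n c) 1+c<w) , belowG c<d))) separate
  where
  1+c<w : suc c < suc c + w₁
  1+c<w = <-≤-trans c<d (subst (d ≤_) (sym d+w₂≡w) (m≤m+n d w₂))

  separate : ¬ SameBlock s (L ∷ Ls) (F c) (F (suc c))
  separate (inj₁ (_ , F<)) = <⇒≱ F< (subst (λ x → s + L ≤ F x) (+-identityʳ (suc c))
    (aboveF {0} (+-cancelˡ-< (suc c) 0 w₁ (subst (_< suc c + w₁) (sym (+-identityʳ (suc c))) 1+c<w))))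
  separate (inj₂ ij) = <⇒≱ (belowF (n<1+n c)) (sameBlock-≥ (s + L) Ls ij)
desynchronised {s} {L} {Ls} {F = F} {M = M} T Ls≤M 1≤M
  (cut zero w refl _ aboveF) (cut (suc d) w₂ refl belowG aboveG) _ = begin
    w + (suc d + w₂)       ≡⟨ rearrange w (suc d) w₂ ⟩
    -- Ascents of `G` in the first block force `F 0` to `F d` into one later block, so `suc d ≤ M`.
    -- The remaining `w + w₂` elements are disjoint and all lie in later blocks.
    suc d + (w + w₂)       ≤⟨ +-mono-≤ (length≤M d ≤-refl) outside ⟩
    M + sum Ls             ∎
  where
  open ≤-Reasoning

  rearrange : ∀ x y z → x + (y + z) ≡ y + (x + z)
  rearrange = solve-∀

  d<w : d < w
  d<w = s≤s (m≤m+n d w₂)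

  link : ∀ x → suc x ≤ d → SameBlock (s + L) Ls (F x) (F (suc x))
  link x x<d = sameBlock-tail (aboveF (≤-<-trans x<d d<w))
    (from (shape T x (≤-<-trans x<d d<w))
      (inj₁ (lower (incG T) (<-trans x<d d<w) , belowG (s≤s x<d))))

  chain : ∀ x → suc x ≤ d → SameBlock (s + L) Ls (F 0) (F (suc x))
  chain zero    x<d = link zero x<d
  chain (suc x) x<d = sameBlock-trans (s + L) Ls (<⇒≤ (mono (incF T) z<s (≤-<-trans x<d d<w)))
    (chain x (<⇒≤ x<d)) (link (suc x) x<d)

  length≤M : ∀ x → x ≤ d → suc x ≤ M
  -- A single element has no ascent linking it to a block, so `1≤M` supplies the bound.
  length≤M zero    _   = 1≤M
  length≤M (suc x) x<d = +-cancelˡ-≤ (F 0) (suc (suc x)) M (begin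
    F 0 + suc (suc x)    ≡⟨ +-suc (F 0) (suc x) ⟩
    suc (F 0 + suc x)    ≤⟨ s≤s (increasing-gap (incF T) (suc x) (≤-<-trans x<d d<w)) ⟩
    suc (F (suc x))      ≤⟨ sameBlock-< (s + L) Ls Ls≤M (chain x x<d) ⟩
    F 0 + M              ∎)

  outside : w + w₂ ≤ sum Ls
  outside = disjoint-count (dropBlock L 0 (incF T) aboveF) (dropBlock L (suc d) (incG T) aboveG)
    λ x<w y<w₂ → disjoint T x<w (+-monoʳ-< (suc d) y<w₂)

-- In a block of size L = M + g or more, twins using different numbers of elements
-- waste at least g; twins using the same number waste at least h, which is 1 for
-- odd L and 0 in general.
data Staircase (g : ℕ) : ℕ → List ℕ → Set where
  []   : Staircase g 0 []
  step : ∀ {k Ls} h {L M} → (∀ c → c + c ≤ L → h + (c + c) ≤ L) →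
         All (_≤ M) Ls → 1 ≤ M → M + g ≤ L → h + k ≤ g →
         Staircase g k Ls → Staircase g (h + k) (L ∷ Ls)

-- Induction over blocks. A balanced first block wastes `h` and leaves twins in the tail; an
-- unbalanced one wastes `g` at once, which by `h + k ≤ g` pays for the whole claim.
staircase-waste : ∀ {g k Ls} → Staircase g k Ls → ∀ {s w F G} → Twins s Ls w F G → k + (w + w) ≤ sum Ls
staircase-waste [] T = disjoint-count (incF T) (incG T) (disjoint T)
staircase-waste {g} (step {k} {Ls} h {L} {M} parity Ls≤M 1≤M M+g≤L h+k≤g stairs) {s} {w} {F} {G} T =
  compare (splitIncreasing (s + L) w (incF T)) (splitIncreasing (s + L) w (incG T))
  where
  open ≤-Reasoning

  unbalanced : w + w ≤ M + sum Ls → h + k + (w + w) ≤ L + sum Ls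
  unbalanced w+w≤ = begin
    h + k + (w + w)      ≤⟨ +-mono-≤ h+k≤g w+w≤ ⟩
    g + (M + sum Ls)     ≡⟨ rearrange g M (sum Ls) ⟩
    M + g + sum Ls       ≤⟨ +-monoˡ-≤ (sum Ls) M+g≤L ⟩
    L + sum Ls           ∎
    where
    rearrange : ∀ x y z → x + (y + z) ≡ y + x + z
    rearrange = solve-∀

  compare : SplitAt (s + L) w F → SplitAt (s + L) w G → h + k + (w + w) ≤ L + sum Ls
  compare A@(cut c v refl belowF aboveF) B@(cut d v′ c+v≡d+v′ belowG aboveG) with <-cmp c d
  ... | tri< c<d _ _ = unbalanced (desynchronised T Ls≤M 1≤M A B c<d)
  ... | tri> _ _ d<c = unbalanced (desynchronised (swap T) Ls≤M 1≤M B A d<c)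
  ... | tri≈ _ refl _ with refl ← +-cancelˡ-≡ c v v′ c+v≡d+v′ = begin
    h + k + (c + v + (c + v))        ≡⟨ rearrange h k c v ⟩
    h + (c + c) + (k + (v + v))      ≤⟨ +-mono-≤ (parity c inBlock)
                                          (staircase-waste stairs (dropTwins c T aboveF aboveG)) ⟩
    L + sum Ls                       ∎
    where
    rearrange : ∀ h k c v → h + k + (c + v + (c + v)) ≡ h + (c + c) + (k + (v + v))
    rearrange = solve-∀

    c≤w : c ≤ c + v
    c≤w = m≤m+n c v

    inBlock : c + c ≤ L
    inBlock = disjoint-count (take c≤w (incF T) belowF) (take c≤w (incG T) belowG)
      λ x<c y<c → disjoint T (<-≤-trans x<c c≤w) (<-≤-trans y<c c≤w)

-- Choice of the block sizes.

-- The odd sizes 2kj + 1, ..., 2k + 1 drop by `g = k + k` each time; with `j = k` their sum has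
-- order k^3.
stairs : ℕ → ℕ → List ℕ
stairs k zero    = []
stairs k (suc j) = suc (k * suc j + k * suc j) ∷ stairs k j

sum-stairs : ∀ k j → sum (stairs k j) ≡ j + k * (j * suc j)
sum-stairs k zero    = sym (*-zeroʳ k)
sum-stairs k (suc j) rewrite sum-stairs k j = identity k j
  where
  identity : ∀ k j → suc (k * suc j + k * suc j) + (j + k * (j * suc j)) ≡ suc j + k * (suc j * suc (suc j))
  identity = solve-∀

stairs-bounded : ∀ k j → All (_≤ suc (k * j + k * j)) (stairs k j)
stairs-bounded k zero    = []
stairs-bounded k (suc j) = ≤-refl ∷ All.map (λ L≤ → ≤-trans L≤ (s≤s (+-mono-≤ k*j≤ k*j≤))) (stairs-bounded k j)
  where k*j≤ = *-monoʳ-≤ k (n≤1+n j)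

double≤odd : ∀ m c → c + c ≤ suc (m + m) → suc (c + c) ≤ suc (m + m)
double≤odd m c c+c≤ with c ≤? m
... | yes c≤m = s≤s (+-mono-≤ c≤m c≤m)
... | no c≰m  = contradiction (≤-trans (+-mono-≤ (≰⇒> c≰m) (≰⇒> c≰m)) c+c≤)
  (<⇒≱ (s≤s (≤-reflexive (sym (+-suc m m)))))

stairs-staircase : ∀ k j → j ≤ k + k → Staircase (k + k) j (stairs k j)
stairs-staircase k zero    _   = []
stairs-staircase k (suc j) j<g =
  step 1 (double≤odd (k * suc j)) (stairs-bounded k j) (s≤s z≤n) (≤-reflexive (identity k j)) j<g
    (stairs-staircase k j (<⇒≤ j<g))
  where
  identity : ∀ k j → suc (k * j + k * j) + (k + k) ≡ suc (k * suc j + k * suc j)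
  identity = solve-∀

-- The surplus of n over the sizes of the odd blocks goes into the first block.
staircase : ∀ n k → suc k ^ 3 ≤ n → ∃ λ Ls → sum Ls ≡ n × Staircase (k + k) k Ls
staircase n k cube≤n =
  n ∸ sum (stairs k k) ∷ stairs k k ,
  m∸n+n≡m (≤-trans (m≤n+m (sum (stairs k k)) (suc (k * k + k * k) + (k + k))) (≤-trans (≤-reflexive cube≡) cube≤n)) ,
  -- The surplus block has unknown parity, hence `h = 0`; the waste `k` comes from the `k` odd
  -- blocks.
  step 0 (λ _ c+c≤L → c+c≤L) (stairs-bounded k k) (s≤s z≤n)
    (m+n≤o⇒m≤o∸n _ (≤-trans (≤-reflexive cube≡) cube≤n)) (m≤m+n k k)
    (stairs-staircase k k (m≤m+n k k))
  where
  -- The smallest admissible first block, `M + g` with M = 2k^2 + 1 and g = 2k, brings the total to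
  -- exactly (k + 1)^3.
  cube≡ : suc (k * k + k * k) + (k + k) + sum (stairs k k) ≡ suc k ^ 3
  cube≡ rewrite sum-stairs k k = identity k
    where
    identity : ∀ k → suc (k * k + k * k) + (k + k) + (k + k * (k * suc k)) ≡ suc k * (suc k * (suc k * 1))
    identity = solve-∀

-- Transfer to `HasWeakTwins` and the cube-root bound.

-- The default 0 is harmless: every condition on twins concerns indices below `w`.
extend₀ : ∀ {w n} → (Fin w → Fin n) → ℕ → ℕ
extend₀ {w} I x with x <? w
... | yes x<w = toℕ (I (fromℕ< x<w))
... | no  _   = 0

extend₀-< : ∀ {w n} (I : Fin w → Fin n) {x} (x<w : x < w) → extend₀ I x ≡ toℕ (I (fromℕ< x<w))
extend₀-< {w} I {x} x<w with x <? w
... | yes _   = refl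
... | no  x≮w = contradiction x<w x≮w

extend₀-increasing : ∀ {w n} (I : Fin w → Fin n) → StrictlyIncreasing I → Increasing 0 n w (extend₀ I)
extend₀-increasing {w} {n} I inc = record
  { mono  = λ {x} {y} x<y y<w → let x<w = <-trans x<y y<w in
      subst₂ _<_ (sym (extend₀-< I x<w)) (sym (extend₀-< I y<w))
        (inc _ _ (subst₂ _<_ (sym (toℕ-fromℕ< x<w)) (sym (toℕ-fromℕ< y<w)) x<y))
  ; lower = λ _ → z≤n
  ; upper = λ x<w → subst (_< n) (sym (extend₀-< I x<w)) (toℕ<n (I (fromℕ< x<w)))
  }

weakTwins⇒twins : ∀ Ls {w} → HasWeakTwins (layered Ls) w → ∃ λ F → ∃ λ G → Twins 0 Ls w F G
weakTwins⇒twins Ls {w} (I , J , incI , incJ , disj , sameShape) = extend₀ I , extend₀ J , record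
  { incF     = extend₀-increasing I incI
  ; incG     = extend₀-increasing J incJ
  ; disjoint = λ x<w y<w eq → disj _ _ (toℕ-injective
      (trans (sym (extend₀-< I x<w)) (trans eq (extend₀-< J y<w))))
  ; shape    = shape′
  }
  where
  shape′ : Shape 0 Ls w (extend₀ I) (extend₀ J)
  shape′ x 1+x<w
    rewrite extend₀-< I (<-trans (n<1+n x) 1+x<w) | extend₀-< J (<-trans (n<1+n x) 1+x<w)
          | extend₀-< I 1+x<w | extend₀-< J 1+x<w =
    ascentJ ⇔-∘ (sameShape a b b≡1+a ⇔-∘ ⇔-sym ascentI)
    where
    a b : Fin w
    a = fromℕ< (<-trans (n<1+n x) 1+x<w)
    b = fromℕ< 1+x<w
    b≡1+a : toℕ b ≡ suc (toℕ a)
    b≡1+a = trans (toℕ-fromℕ< 1+x<w) (cong suc (sym (toℕ-fromℕ< (<-trans (n<1+n x) 1+x<w))))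
    a<b : a Fin.< b
    a<b = ≤-reflexive (sym b≡1+a)
    ascentI = layered-ascent Ls 0 (I a) (I b) (incI a b a<b)
    ascentJ = layered-ascent Ls 0 (J a) (J b) (incJ a b a<b)

-- Induction from 8 = 2^3, which starts at `k = 1`; `k` grows by one whenever the upper bound fails.
cubeRoot : ∀ n → 8 ≤ n → ∃ λ k → 1 ≤ k × suc k ^ 3 ≤ n × n ≤ (2 + k) ^ 3
cubeRoot n 8≤n with d , refl ← m≤n⇒∃[o]m+o≡n 8≤n = go d
  where
  go : ∀ d → ∃ λ k → 1 ≤ k × suc k ^ 3 ≤ 8 + d × 8 + d ≤ (2 + k) ^ 3
  go zero = 1 , ≤-refl , ≤-refl , m≤m+n 8 19
  go (suc d) rewrite +-suc 8 d with go d
  ... | k , 1≤k , lo , hi with 9 + d ≤? (2 + k) ^ 3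
  ...   | yes hi′ = k , 1≤k , m≤n⇒m≤1+n lo , hi′
  ...   | no ≰    = suc k , s≤s z≤n , <⇒≤ (≰⇒> ≰) , ≤-<-trans hi (^-monoˡ-< 3 (n<1+n (2 + k)))

-- Cubing avoids roots: the conclusion says w ≤ n/2 - n^(1/3)/6, so c = 1/6.
upperBound : ∀ n → 8 ≤ n → Σ (Permutation′ n) λ π →
             (w : ℕ) → HasWeakTwins π w → 1 * n ≤ 27 * ((n ∸ 2 * w) ^ 3)
upperBound n 8≤n with k , 1≤k , lo , hi ← cubeRoot n 8≤n with staircase n k lo
... | Ls , refl , st = layered Ls , bound
  where
  bound : ∀ w → HasWeakTwins (layered Ls) w → 1 * sum Ls ≤ 27 * ((sum Ls ∸ 2 * w) ^ 3)
  bound w twins with F , G , T ← weakTwins⇒twins Ls twins = begin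
    1 * sum Ls                       ≡⟨ *-identityˡ (sum Ls) ⟩
    sum Ls                           ≤⟨ hi ⟩
    -- From `1 ≤ k` follows 2 + k ≤ 3k, whence the constant 27.
    (2 + k) ^ 3                      ≤⟨ ^-monoˡ-≤ 3 (+-monoˡ-≤ k (+-mono-≤ 1≤k 1≤k)) ⟩
    (k + k + k) ^ 3                  ≡⟨ identity k ⟩
    27 * k ^ 3                       ≤⟨ *-monoʳ-≤ 27 (^-monoˡ-≤ 3 k≤waste) ⟩
    27 * ((sum Ls ∸ 2 * w) ^ 3)      ∎
    where
    open ≤-Reasoning

    identity : ∀ k → (k + k + k) * ((k + k + k) * ((k + k + k) * 1)) ≡ 27 * (k * (k * (k * 1)))
    identity = solve-∀

    2w≡ : w + w ≡ 2 * w
    2w≡ = cong (w +_) (sym (+-identityʳ w))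

    k≤waste : k ≤ sum Ls ∸ 2 * w
    k≤waste = m+n≤o⇒m≤o∸n k (subst (λ v → k + v ≤ sum Ls) 2w≡ (staircase-waste st T))

theorem1 : (Σ ℕ λ N → (n : ℕ) → N ≤ n → (π : Permutation′ n) →
    Σ ℕ λ w → HasWeakTwins π w × n ≤ 12 * w)
    ×
    (Σ ℕ λ p → Σ ℕ λ q → NonZero p × NonZero q ×
    Σ ℕ λ N → (n : ℕ) → N ≤ n → Σ (Permutation′ n) λ π →
    (w : ℕ) → HasWeakTwins π w → p * n ≤ q * ((n ∸ 2 * w) ^ 3))
theorem1 = (4 , lowerBound) , (1 , 27 , _ , _ , 8 , upperBound)
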